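{- Let $W$ be a finite Coxeter group presented with generators $s_1,\dots,s_n$ ($n\geq 1$), and let $H_0(W)$ be its associated $0$-Hecke monoid. Then $H_0(W)$ is not Ramsey, except in the degenerate case that $W$ has only one generator (i.e. if $n\geq 2$, then $H_0(W)$ is not Ramsey).
   Context: A Coxeter group is a group $W$ given by a presentation $W=\langle s_1,\dots,s_n \mid (s_is_j)^{m_{ij}}=1\rangle$ with $m_{ii}=1$ and $2\leq m_{ij}=m_{ji}\leq\infty$ for $i\neq j$. Equivalently, the relations are $s_i^2=1$ together with the braid relations $s_is_js_i\cdots = s_js_is_j\cdots$ for $i\ne j$ (alternating products with $m_{ij}$ factors on each side). For finite $W$, the $0$-Hecke monoid $H_0(W)$ is the monoid generated by $\pi_1,\dots,\pi_n$ subject to $\pi_i^2=\pi_i$ and the same braid relations $\pi_i\pi_j\pi_i\cdots=\pi_j\pi_i\pi_j\cdots$ ($m_{ij}$ factors on each side). Ramsey monoids: let $M$ be a finite monoid. A pointed $M$-set is a set $X$ with an action of $M$ and a distinguished point $x\in X$ such that $Mx=X$. Given a sequence $(X_n)_{n\in\mathbb{N}}$ of pointed $M$-sets, treated as mutually disjoint, let $\langle (X_n)\rangle$ be the set of all finite partial functions $f:\mathbb{N}\to\bigcup_n X_n$ with $f(n)\in X_n$ for all $n\in\operatorname{dom}(f)$. For $f,g\in\langle (X_n)\rangle$ write $f\prec g$ if $\max(\operatorname{dom}(f))<\min(\operatorname{dom}(g))$; in that case the product $fg$ is defined to be $f\cup g\in\langle (X_n)\rangle$. $M$ acts on $\langle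 (X_n)\rangle$ coordinatewise: $m(f)$ has the same domain as $f$ and $m(f)(n)=m\cdot f(n)$. The sequence $(X_n)$ has the Ramsey property if for every finite colouring of $\langle (X_n)\rangle$ there is a sequence $B=\{f_i\}_{i\in\mathbb{N}}\subseteq\langle (X_n)\rangle$ such that: (1) $f_i\prec f_{i+1}$ for all $i$; (2) for each $i$, the range of $f_i$ includes the distinguished element of $X_n$ for some $n\in\operatorname{dom}(f_i)$; (3) the set $[B]=\{m_0(f_{i_0})\cdots m_k(f_{i_k}) : k\in\mathbb{N},\ i_0<\dots<i_k,\ m_j\in M \text{ for all } j,\ m_j=1_M\text{ for at least one } j\}$ is monochromatic. $M$ is Ramsey if every sequence of pointed $M$-sets has the Ramsey property. -}

module Defs where

open import Algebra.Bundles using (Group; Monoid)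
open import Data.Fin.Base as Fin using (Fin)
open import Data.List.Base using (List; []; _∷_; [_]; _++_)
open import Data.List.Properties using (++-assoc; ++-identityʳ)
open import Data.Maybe.Base using (Maybe; just; nothing; map; _<∣>_)
open import Data.Maybe using (Is-just)
import Data.Maybe.Relation.Binary.Pointwise as Maybe
open import Data.Nat.Base using (ℕ; zero; suc; _≤_; _<_; _⊔_)
open import Data.Nat.Properties using (m⊔n≤o⇒m≤o; m⊔n≤o⇒n≤o)
open import Data.Product.Base using (Σ-syntax; ∃-syntax; _×_; _,_)
open import Function.Base using (_∘_)
open import Function.Bundles using (Func; Inverse)
open import Level using (Level; 0ℓ) renaming (_⊔_ to _⊔ˡ_; suc to lsuc)
open import Relation.Binary.Bundles using (Setoid)
open import Relation.Binary.Core using (Rel)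
open import Relation.Binary.PropositionalEquality using (_≡_; _≢_; refl; cong; cong₂)
import Relation.Binary.PropositionalEquality as ≡
open import Relation.Binary.Construct.Add.Supremum.NonStrict _≤_ using (_≤⁺_)
open import Relation.Nullary.Construct.Add.Supremum using (_⁺) renaming ([_] to fin)
open import Relation.Unary using (Pred; _∈_)

module GroupPresentation (A : Set) where

  infixl 7 _∙_
  infix  8 _⁻¹ _^_

  data Term : Set where
    gen : A → Term
    ε   : Term
    _∙_ : Term → Term → Term
    _⁻¹ : Term → Term

  _^_ : Term → ℕ → Term
  t ^ zero  = ε
  t ^ suc k = t ∙ t ^ k

  module _ (R : Rel Term 0ℓ) where

    infix 4 _≈_

    data _≈_ : Rel Term 0ℓ where
      relation  : ∀ {t u} → R t u → t ≈ u
      ≈-refl    : ∀ {t} → t ≈ t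
      ≈-sym     : ∀ {t u} → t ≈ u → u ≈ t
      ≈-trans   : ∀ {t u v} → t ≈ u → u ≈ v → t ≈ v
      ∙-cong    : ∀ {t t′ u u′} → t ≈ t′ → u ≈ u′ → t ∙ u ≈ t′ ∙ u′
      ⁻¹-cong   : ∀ {t t′} → t ≈ t′ → t ⁻¹ ≈ t′ ⁻¹
      assoc     : ∀ t u v → (t ∙ u) ∙ v ≈ t ∙ (u ∙ v)
      identityˡ : ∀ t → ε ∙ t ≈ t
      identityʳ : ∀ t → t ∙ ε ≈ t
      inverseˡ  : ∀ t → t ⁻¹ ∙ t ≈ ε
      inverseʳ  : ∀ t → t ∙ t ⁻¹ ≈ ε

    group : Group 0ℓ 0ℓ
    group = record
      { Carrier = Term
      ; _≈_     = _≈_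
      ; _∙_     = _∙_
      ; ε       = ε
      ; _⁻¹     = _⁻¹
      ; isGroup = record
        { isMonoid = record
          { isSemigroup = record
            { isMagma = record
              { isEquivalence = record { refl = ≈-refl ; sym = ≈-sym ; trans = ≈-trans }
              ; ∙-cong        = ∙-cong
              }
            ; assoc = assoc
            }
          ; identity = identityˡ , identityʳ
          }
        ; inverse = inverseˡ , inverseʳ
        ; ⁻¹-cong = ⁻¹-cong
        }
      }

module MonoidPresentation (A : Set) (R : Rel (List A) 0ℓ) where

  infix 4 _≈_

  data _≈_ : Rel (List A) 0ℓ where
    relation : ∀ {u v} → R u v → u ≈ v
    ≈-refl   : ∀ {u} → u ≈ u
    ≈-sym    : ∀ {u v} → u ≈ v → v ≈ u
    ≈-trans  : ∀ {u v w} → u ≈ v → v ≈ w → u ≈ w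
    ++-cong  : ∀ {u u′ v v′} → u ≈ u′ → v ≈ v′ → u ++ v ≈ u′ ++ v′

  ≈-reflexive : ∀ {u v} → u ≡ v → u ≈ v
  ≈-reflexive refl = ≈-refl

  monoid : Monoid 0ℓ 0ℓ
  monoid = record
    { Carrier  = List A
    ; _≈_      = _≈_
    ; _∙_      = _++_
    ; ε        = []
    ; isMonoid = record
      { isSemigroup = record
        { isMagma = record
          { isEquivalence = record { refl = ≈-refl ; sym = ≈-sym ; trans = ≈-trans }
          ; ∙-cong        = ++-cong
          }
        ; assoc = λ u v w → ≈-reflexive (++-assoc u v w)
        }
      ; identity = (λ _ → ≈-refl) , (λ u → ≈-reflexive (++-identityʳ u))
      }
    }

-- Entries lie in ℕ ∪ {∞}, with ∞ the added supremum.
record CoxeterMatrix (n : ℕ) : Set where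
  field
    m            : Fin n → Fin n → ℕ ⁺
    diagonal     : ∀ i → m i i ≡ fin 1
    off-diagonal : ∀ {i j} → i ≢ j → fin 2 ≤⁺ m i j
    symmetric    : ∀ i j → m i j ≡ m j i

module _ {n : ℕ} (C : CoxeterMatrix n) where

  open CoxeterMatrix C
  open GroupPresentation (Fin n)

  -- An infinite entry m i j imposes no relation.
  data CoxeterRelation : Rel Term 0ℓ where
    coxeter : ∀ {i j k} → m i j ≡ fin k → CoxeterRelation ((gen i ∙ gen j) ^ k) ε

  CoxeterGroup : Group 0ℓ 0ℓ
  CoxeterGroup = group CoxeterRelation

-- The word i j i ⋯ with k letters.
alternating : {A : Set} → ℕ → A → A → List A
alternating zero    i j = []
alternating (suc k) i j = i ∷ alternating k j i

module _ {n : ℕ} (C : CoxeterMatrix n) where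

  open CoxeterMatrix C

  data HeckeRelation : Rel (List (Fin n)) 0ℓ where
    idempotent : ∀ i → HeckeRelation (i ∷ i ∷ []) [ i ]
    braid      : ∀ {i j k} → i ≢ j → m i j ≡ fin k →
                 HeckeRelation (alternating k i j) (alternating k j i)

  ZeroHeckeMonoid : Monoid 0ℓ 0ℓ
  ZeroHeckeMonoid = MonoidPresentation.monoid (Fin n) HeckeRelation

IsFinite : ∀ {a ℓ} → Setoid a ℓ → Set (a ⊔ˡ ℓ)
IsFinite S = ∃[ k ] Inverse S (≡.setoid (Fin k))

module _ {c ℓ : Level} (M : Monoid c ℓ) where

  private module M = Monoid M

  record PointedMSet : Set (lsuc (c ⊔ˡ ℓ)) where
    infixr 7 _·_
    field
      setoid : Setoid c ℓ

    open Setoid setoid public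

    field
      _·_        : M.Carrier → Carrier → Carrier
      ·-cong     : ∀ {a b x y} → a M.≈ b → x ≈ y → a · x ≈ b · y
      ·-identity : ∀ x → M.ε · x ≈ x
      ·-assoc    : ∀ a b x → (a M.∙ b) · x ≈ a · (b · x)
      point      : Carrier
      generates  : ∀ x → ∃[ a ] a · point ≈ x

  module _ (X : ℕ → PointedMSet) where

    private module X (i : ℕ) = PointedMSet (X i)

    -- Finite partial functions f with f(i) ∈ Xᵢ. The bound only witnesses
    -- finiteness of the domain and is ignored by the equality _≈ᶠ_.
    record FinPartial : Set c where
      field
        at     : (i : ℕ) → Maybe (X.Carrier i)
        bound  : ℕ
        beyond : ∀ i → bound ≤ i → at i ≡ nothing

    open FinPartial

    infix 4 _∈dom_ _≈ᶠ_ _≺_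
    infixr 6 _∪_
    infixr 7 _•_

    _∈dom_ : ℕ → FinPartial → Set c
    i ∈dom f = Is-just (at f i)

    _≈ᶠ_ : Rel FinPartial (c ⊔ˡ ℓ)
    f ≈ᶠ g = ∀ i → Maybe.Pointwise (X._≈_ i) (at f i) (at g i)

    finPartialSetoid : Setoid c (c ⊔ˡ ℓ)
    finPartialSetoid = record
      { Carrier       = FinPartial
      ; _≈_           = _≈ᶠ_
      ; isEquivalence = record
        { refl  = λ i → Maybe.refl (X.refl i)
        ; sym   = λ p i → Maybe.sym (X.sym i) (p i)
        ; trans = λ p q i → Maybe.trans (X.trans i) (p i) (q i)
        }
      }

    -- max (dom f) < min (dom g), holding vacuously if a domain is empty.
    _≺_ : Rel FinPartial c
    f ≺ g = ∀ {i j} → i ∈dom f → j ∈dom g → i < j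

    -- The product fg; only meaningful when f ≺ g (in general it is
    -- biased to the left where the domains overlap).
    _∪_ : FinPartial → FinPartial → FinPartial
    f ∪ g = record
      { at     = λ i → at f i <∣> at g i
      ; bound  = bound f ⊔ bound g
      ; beyond = λ i b≤i → cong₂ _<∣>_
          (beyond f i (m⊔n≤o⇒m≤o (bound f) (bound g) b≤i))
          (beyond g i (m⊔n≤o⇒n≤o (bound f) (bound g) b≤i))
      }

    _•_ : M.Carrier → FinPartial → FinPartial
    a • f = record
      { at     = λ i → map (X._·_ i a) (at f i)
      ; bound  = bound f
      ; beyond = λ i b≤i → cong (map (X._·_ i a)) (beyond f i b≤i)
      }

    product : ∀ k → (Fin (suc k) → FinPartial) → FinPartial
    product zero    g = g Fin.zero
    product (suc k) g = g Fin.zero ∪ product k (g ∘ Fin.suc)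

    -- The set [B] for B = {fᵢ}.
    Span : (ℕ → FinPartial) → Pred FinPartial (c ⊔ˡ ℓ)
    Span f g =
      Σ[ k ∈ ℕ ] Σ[ i ∈ (Fin (suc k) → ℕ) ] Σ[ a ∈ (Fin (suc k) → M.Carrier) ]
        (∀ {p q} → p Fin.< q → i p < i q) ×
        (∃[ p ] a p M.≈ M.ε) ×
        (g ≈ᶠ product k (λ p → a p • f (i p)))

    Monochromatic : ∀ {r p} → Func finPartialSetoid (≡.setoid (Fin r)) →
                    Pred FinPartial p → Set (c ⊔ˡ p)
    Monochromatic χ P = ∃[ colour ] (∀ {g} → g ∈ P → Func.to χ g ≡ colour)

    HasRamseyProperty : Set (c ⊔ˡ ℓ)
    HasRamseyProperty =
      ∀ r (χ : Func finPartialSetoid (≡.setoid (Fin r))) →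
      ∃[ f ]
        (∀ i → f i ≺ f (suc i)) ×
        (∀ i → ∃[ n ] Maybe.Pointwise (X._≈_ n) (at (f i) n) (just (X.point n))) ×
        Monochromatic χ (Span f)

  IsRamsey : Set (lsuc (c ⊔ˡ ℓ))
  IsRamsey = ∀ (X : ℕ → PointedMSet) → HasRamseyProperty X

{-# OPTIONS --safe #-}

-- Each braid relation has the same letters on both sides, so "which of two
-- distinct generators s, t occur in w" is a homomorphism from H₀(W) onto the
-- free semilattice {1, s, t, st}. Let every Xₙ be this semilattice, pointed at 1,
-- and colour f by whichever of the letters s, t occurs first among its values.
-- If f₀ ≺ f₁ and f₀ takes the value 1, then s(f₀)f₁ takes the value s before any
-- value t, while t(f₀)f₁ takes t before any s, so [B] is never monochromatic.
module Submission where

open import Defs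
open import Algebra.Bundles using (Group)
open import Data.Bool.Base using (Bool; true; false; _∨_)
open import Data.Bool.ListAction using (any)
open import Data.Bool.Properties using (∨-assoc; ∨-comm; ∨-idem; ∨-identityʳ)
open import Data.Fin.Base using (Fin; zero; suc; toℕ)
open import Data.Fin.Properties using (0≢1+n)
open import Data.List.Base using (List; []; _∷_; [_]; _++_)
open import Data.Maybe.Base using (Maybe; just; nothing)
import Data.Maybe.Relation.Binary.Pointwise as Maybe
open import Data.Maybe.Relation.Unary.Any using (just)
open import Data.Nat.Base using (ℕ; zero; suc; _≤_; _<_; z≤n; s≤s)
open import Data.Nat.Properties using (≤⇒≯; ≰⇒>)
open import Data.Product.Base using (_×_; _,_)
open import Data.Unit.Base using (tt)
open import Function.Base using (_∘_; id)
open import Function.Bundles using (Func)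
open import Relation.Binary.Construct.Add.Supremum.NonStrict _≤_ using (_≤⁺_; [≤]-injective)
open import Relation.Binary.PropositionalEquality using (_≡_; refl; sym; trans; cong; cong₂; subst; setoid; module ≡-Reasoning)
open import Relation.Nullary.Construct.Add.Supremum using () renaming ([_] to fin)
open import Relation.Nullary.Negation using (¬_; contradiction)

private
  variable
    A : Set
    r : Fin 2
    n : ℕ

any-++ : (p : A → Bool) (u v : List A) → any p (u ++ v) ≡ any p u ∨ any p v
any-++ p []      v = refl
any-++ p (x ∷ u) v = trans (cong (p x ∨_) (any-++ p u v)) (sym (∨-assoc (p x) _ _))

-- Two letters already exhibit both `i` and `j`; every further letter repeats one of them and is
-- absorbed by idempotence of `∨`.
any-alternating : ∀ k (p : A → Bool) (i j : A) → 2 ≤ k → any p (alternating k i j) ≡ p i ∨ p j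
any-alternating 2 p i j _ = cong (p i ∨_) (∨-identityʳ (p j))
any-alternating 1 p i j (s≤s ())
any-alternating (suc (suc (suc k))) p i j _ = begin
  p i ∨ any p (alternating (suc (suc k)) j i) ≡⟨ cong (p i ∨_) (any-alternating (suc (suc k)) p j i (s≤s (s≤s z≤n))) ⟩
  p i ∨ (p j ∨ p i)                           ≡⟨ cong (p i ∨_) (∨-comm (p j) (p i)) ⟩
  p i ∨ (p i ∨ p j)                           ≡⟨ ∨-assoc (p i) (p i) (p j) ⟨
  (p i ∨ p i) ∨ p j                           ≡⟨ cong (_∨ p j) (∨-idem (p i)) ⟩
  p i ∨ p j                                   ∎
  where open ≡-Reasoning

module _ (W : CoxeterMatrix n) where

  open CoxeterMatrix W
  open MonoidPresentation (Fin n) (HeckeRelation W)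

  any-relation : (p : Fin n → Bool) {u v : List (Fin n)} → HeckeRelation W u v → any p u ≡ any p v
  any-relation p (idempotent i) =
    trans (sym (∨-assoc (p i) (p i) false)) (cong (_∨ false) (∨-idem (p i)))
  any-relation p (braid {i} {j} {k} i≢j mᵢⱼ≡k) =
    trans (any-alternating k p i j 2≤k) (trans (∨-comm (p i) (p j)) (sym (any-alternating k p j i 2≤k)))
    -- Off-diagonal entries are at least 2, so both sides of the braid relation contain both
    -- letters.
    where 2≤k = [≤]-injective (subst (fin 2 ≤⁺_) mᵢⱼ≡k (off-diagonal i≢j))

  any-≈ : (p : Fin n → Bool) {u v : List (Fin n)} → u ≈ v → any p u ≡ any p v
  any-≈ p (relation R)  = any-relation p R
  any-≈ p ≈-refl        = refl
  any-≈ p (≈-sym e)     = sym (any-≈ p e)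
  any-≈ p (≈-trans e f) = trans (any-≈ p e) (any-≈ p f)
  any-≈ p (++-cong {u} {u′} {v} {v′} e f) =
    trans (any-++ p u v) (trans (cong₂ _∨_ (any-≈ p e) (any-≈ p f)) (sym (any-++ p u′ v′)))

is-zero is-one : Fin (suc (suc n)) → Bool
is-zero zero    = true
is-zero (suc _) = false
is-one (suc zero) = true
is-one _          = false

-- The subset of {0, 1} with indicator values (x , y).
Content : Set
Content = Bool × Bool

-- A word acts by union with the set of its letters among 0 and 1; all other generators act
-- trivially.
contentSet : (W : CoxeterMatrix (suc (suc n))) → PointedMSet (ZeroHeckeMonoid W)
contentSet W = record
  { setoid     = setoid Content
  ; _·_        = λ { w (x , y) → any is-zero w ∨ x , any is-one w ∨ y }
  ; ·-cong     = λ { {y = x , y} u≈v refl →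
                     cong₂ (λ a b → a ∨ x , b ∨ y) (any-≈ W is-zero u≈v) (any-≈ W is-one u≈v) }
  ; ·-identity = λ _ → refl
  ; ·-assoc    = λ { u v (x , y) → cong₂ _,_ (any-++-∨ is-zero u v x) (any-++-∨ is-one u v y) }
  ; point      = false , false
  ; generates  = λ where
      (false , false) → [] , refl
      (false , true)  → [ suc zero ] , refl
      (true  , false) → [ zero ] , refl
      (true  , true)  → zero ∷ suc zero ∷ [] , refl
  }
  where
  any-++-∨ : (p : Fin _ → Bool) (u v : List (Fin _)) (x : Bool) →
             any p (u ++ v) ∨ x ≡ any p u ∨ (any p v ∨ x)
  any-++-∨ p u v x = trans (cong (_∨ x) (any-++ p u v)) (∨-assoc (any p u) _ x)

pointwise-≡⇒≡ : {x y : Maybe A} → Maybe.Pointwise _≡_ x y → x ≡ y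
pointwise-≡⇒≡ (Maybe.just refl) = refl
pointwise-≡⇒≡ Maybe.nothing     = refl

-- The second argument is the colour of everything further right. The full set must defer to it,
-- just as the empty set and gaps do: translating by one letter can produce the full set, which
-- favours neither colour.
step : Maybe Content → Fin 2 → Fin 2
step (just (true  , false)) _ = zero
step (just (false , true))  _ = suc zero
step _                      c = c

-- The junk value 0 is returned if no value of g below the bound is a singleton.
firstSingleton : (ℕ → Maybe Content) → ℕ → Fin 2
firstSingleton g zero    = zero
firstSingleton g (suc b) = step (g zero) (firstSingleton (g ∘ suc) b)

-- Equality of partial functions ignores the bound, so the colour must too: positions past either
-- bound are gaps, which `step` passes over.
firstSingleton-cong : {g h : ℕ → Maybe Content} (b c : ℕ) → (∀ i → g i ≡ h i) →
  (∀ i → b ≤ i → g i ≡ nothing) → (∀ i → c ≤ i → h i ≡ nothing) →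
  firstSingleton g b ≡ firstSingleton h c
firstSingleton-cong zero zero g≗h g∅ h∅ = refl
firstSingleton-cong zero (suc c) g≗h g∅ h∅
  rewrite sym (g≗h zero) | g∅ zero z≤n =
  firstSingleton-cong zero c (g≗h ∘ suc) (λ i _ → g∅ (suc i) z≤n) (λ i → h∅ (suc i) ∘ s≤s)
firstSingleton-cong (suc b) zero g≗h g∅ h∅
  rewrite g≗h zero | h∅ zero z≤n =
  firstSingleton-cong b zero (g≗h ∘ suc) (λ i → g∅ (suc i) ∘ s≤s) (λ i _ → h∅ (suc i) z≤n)
firstSingleton-cong (suc b) (suc c) g≗h g∅ h∅ = cong₂ step (g≗h zero)
  (firstSingleton-cong b c (g≗h ∘ suc) (λ i → g∅ (suc i) ∘ s≤s) (λ i → h∅ (suc i) ∘ s≤s))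

-- Position `d` forces the colour `r` whatever follows it, and folding back through the earlier
-- positions preserves `r`.
firstSingleton-decided : {g : ℕ → Maybe Content} (d b : ℕ) → d < b →
  (∀ i → i ≤ d → step (g i) r ≡ r) → (∀ c → step (g d) c ≡ r) → firstSingleton g b ≡ r
firstSingleton-decided zero    (suc b) _         keep decide = decide _
firstSingleton-decided (suc d) (suc b) (s≤s d<b) keep decide =
  trans (cong (step _) (firstSingleton-decided d b d<b (λ i → keep (suc i) ∘ s≤s) decide))
        (keep zero z≤n)

module _ (W : CoxeterMatrix (suc (suc n))) where

  private
    H₀ = ZeroHeckeMonoid W

    X : ℕ → PointedMSet H₀
    X _ = contentSet W

  open PointedMSet (contentSet W) using (_·_; point)
  open FinPartial

  colouring : Func (finPartialSetoid H₀ X) (setoid (Fin 2))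
  colouring = record
    { to   = λ f → firstSingleton (at f) (bound f)
    ; cong = λ {f} {g} f≈g → firstSingleton-cong (bound f) (bound g)
               (λ i → pointwise-≡⇒≡ (f≈g i)) (beyond f) (beyond g)
    }

  ∈dom-• : (w : List (Fin (suc (suc n)))) (f : FinPartial H₀ X) {i : ℕ} →
    _∈dom_ H₀ X i (_•_ H₀ X w f) → _∈dom_ H₀ X i f
  ∈dom-• w f {i} i∈w•f with at f i | i∈w•f
  ... | just _  | _ = just tt
  ... | nothing | ()

  -- Up to `d` only gaps and translates `w · x` occur, none of which is the singleton of the other
  -- colour; at `d` itself stands `w · point`, the singleton of colour `r`.
  colour-•-∪ : (w : List (Fin (suc (suc n)))) (f g : FinPartial H₀ X) {d : ℕ} →
    (∀ x → step (just (w · x)) r ≡ r) → (∀ c → step (just (w · point)) c ≡ r) →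
    _≺_ H₀ X f g → at f d ≡ just point →
    Func.to colouring (_∪_ H₀ X (_•_ H₀ X w f) g) ≡ r
  colour-•-∪ {r} w f g {d} keep decide f≺g fd≡point =
    firstSingleton-decided d (bound h) (≰⇒> d∈bound) keep′ decide′
    where
    h = _∪_ H₀ X (_•_ H₀ X w f) g

    hd≡ : at h d ≡ just (w · point)
    hd≡ rewrite fd≡point = refl

    d∈bound : ¬ bound h ≤ d
    d∈bound b≤d with () ← trans (sym hd≡) (beyond h d b≤d)

    d∈f : _∈dom_ H₀ X d f
    d∈f rewrite fd≡point = just tt

    decide′ : ∀ c → step (at h d) c ≡ r
    decide′ c rewrite hd≡ = decide c

    keep′ : ∀ i → i ≤ d → step (at h i) r ≡ r
    keep′ i i≤d with at f i | at g i in gi≡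
    ... | just x  | _       = keep x
    ... | nothing | nothing = refl
    -- A value of `g` at or before `d` is impossible, because `d` lies in the domain of `f` and `f`
    -- precedes `g`.
    ... | nothing | just y  = contradiction (f≺g d∈f i∈g) (≤⇒≯ i≤d)
      where
      i∈g : _∈dom_ H₀ X i g
      i∈g rewrite gi≡ = just tt

  not-Ramsey : ¬ IsRamsey H₀
  not-Ramsey ramsey with ramsey X 2 colouring
  ... | f , f≺ , hits-point , c , mono with hits-point 0
  ...   | d , f₀d≈point = 0≢1+n
    (trans (sym (colour-of [ zero ] keep₀ (λ _ → refl))) (colour-of [ suc zero ] keep₁ (λ _ → refl)))
    where
    -- A set containing 0 is either the singleton of 0 or the full set, never the singleton of 1.
    keep₀ : ∀ x → step (just ([ zero ] · x)) zero ≡ zero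
    keep₀ (_ , false) = refl
    keep₀ (_ , true)  = refl

    keep₁ : ∀ x → step (just ([ suc zero ] · x)) (suc zero) ≡ suc zero
    keep₁ (false , _) = refl
    keep₁ (true  , _) = refl

    colour-of : (w : List (Fin (suc (suc n)))) →
      (∀ x → step (just (w · x)) r ≡ r) → (∀ c → step (just (w · point)) c ≡ r) → c ≡ r
    colour-of w keep decide = trans (sym (mono {h} h∈span))
      (colour-•-∪ w (f 0) (_•_ H₀ X [] (f 1)) keep decide f₀≺f₁
        (pointwise-≡⇒≡ f₀d≈point))
      where
      f₀≺f₁ : _≺_ H₀ X (f 0) (_•_ H₀ X [] (f 1))
      f₀≺f₁ i∈f₀ j∈f₁ = f≺ 0 i∈f₀ (∈dom-• [] (f 1) j∈f₁)

      h = _∪_ H₀ X (_•_ H₀ X w (f 0)) (_•_ H₀ X [] (f 1))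

      h∈span : Span H₀ X f h
      -- The factor `f 1` carries the identity coefficient that the span demands, which leaves the
      -- coefficient `w` of `f 0` free.
      h∈span = 1 , toℕ , (λ { zero → w ; (suc _) → [] }) , id ,
        (suc zero , MonoidPresentation.≈-refl) , λ _ → Maybe.refl refl

corollary5p2 : (n : ℕ) (W : CoxeterMatrix n) →
    IsFinite (Group.setoid (CoxeterGroup W)) →
    2 ≤ n →
    ¬ IsRamsey (ZeroHeckeMonoid W)
corollary5p2 (suc (suc n)) W _ _ = not-Ramsey W
corollary5p2 1 W _ (s≤s ())
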